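{- For all $n\ge1$, $$B_n(q)=\sum_{w\in S_n}(-1)^{\ell(w)}q^{\beta(w)}=\prod_{k=1}^{n-1}(1-q^k)^{n-k}.$$
   Context: For $w\in S_n$, $\ell(w)=\#\{(i,j): i<j,\ w(i)>w(j)\}$ is the inversion number. The bigrassmannian statistic of $w$ is $\beta(w)=\sum_{i,j=1}^n\min(i,j)-\sum_{i,j=1}^n\widetilde w(i,j)$, where $\widetilde w(i,j)=\#\{p\le i : w(p)\le j\}$ is the corner sum matrix of the permutation matrix of $w$; equivalently $\beta(w)=\sum_{i=1}^n\frac12(i-w(i))^2$. -}

module Defs where

open import Algebra.Bundles using (CommutativeRing; Semiring)
import Algebra.Definitions.RawSemiring as RawSemiringDefs
import Algebra.Properties.CommutativeMonoid.Sum as MonoidSum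
open import Data.Fin.Base as Fin using (Fin; zero; suc; toℕ; fromℕ<; punchIn)
open import Data.Fin.Permutation as Perm using (Permutation′; _⟨$⟩ʳ_; insert; remove)
import Data.Fin.Properties as Fin
open import Data.List.Base using (List; []; _∷_; allFin; cartesianProduct; cartesianProductWith; filter; foldr; length; lookup; map)
open import Data.List.Membership.Propositional.Properties using (∈-allFin; ∈-lookup)
open import Data.List.Relation.Unary.All as All using (All)
import Data.List.Relation.Unary.All.Properties as All
open import Data.List.Relation.Unary.AllPairs using ([]; _∷_)
open import Data.List.Relation.Unary.Any using (Any; here)
import Data.List.Relation.Unary.Any.Properties as Any
open import Data.List.Relation.Unary.Unique.Propositional using (Unique)
import Data.List.Relation.Unary.Unique.Propositional.Properties as Unique
import Data.List.Relation.Unary.Unique.Setoid as UniqueSetoid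
import Data.List.Relation.Unary.Unique.Setoid.Properties as UniqueSetoid
open import Data.Nat.Base using (ℕ; zero; suc; _∸_; _≤_; _<_; _⊓_; z≤n; s≤s)
import Data.Nat.Properties as ℕ
open import Data.Product.Base using (_×_; _,_; proj₁; proj₂)
open import Function.Base using (_∘_)
open import Function.Bundles using (Injection)
open import Function.Definitions using (Injective)
open import Function.Properties.Inverse using (↔⇒↣)
open import Level using (0ℓ)
open import Relation.Binary.Bundles using (Setoid)
open import Relation.Binary.PropositionalEquality using (_≡_; refl; sym; trans; cong; subst; setoid)
open import Relation.Nullary.Decidable using (_×-dec_)
open import Relation.Nullary.Negation using (contradiction)

open MonoidSum ℕ.+-0-commutativeMonoid using (sum-syntax)

-- Throughout, the element k of Fin n stands for k + 1 in {1, …, n}.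

-- Inversions are unaffected by the shift of indices.
ℓ : ∀ {n} → Permutation′ n → ℕ
ℓ {n} w = length (filter (λ (i , j) → (i Fin.<? j) ×-dec (w ⟨$⟩ʳ j Fin.<? w ⟨$⟩ʳ i))
                         (cartesianProduct (allFin n) (allFin n)))

cornerSum : ∀ {n} → Permutation′ n → Fin n → Fin n → ℕ
cornerSum {n} w i j = length (filter (λ p → (p Fin.≤? i) ×-dec (w ⟨$⟩ʳ p Fin.≤? j)) (allFin n))

-- The subtraction never truncates: see cornerSums≤mins below.
β : ∀ {n} → Permutation′ n → ℕ
β {n} w = (∑[ i < n ] ∑[ j < n ] (suc (toℕ i) ⊓ suc (toℕ j))) ∸ (∑[ i < n ] ∑[ j < n ] cornerSum w i j)

-- S_n, listed without repetition: for n + 1, choose the value j of the first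
-- index and a permutation of the remaining n indices and values.
permutations : ∀ n → List (Permutation′ n)
permutations zero    = Perm.id ∷ []
permutations (suc n) = cartesianProductWith (insert zero) (allFin (suc n)) (permutations n)

-- The identity in ℤ[q] is read as an identity holding for every element q of
-- every commutative ring; ℤ[q] with its indeterminate is one instance.
module _ {c r} (R : CommutativeRing c r) where
  open CommutativeRing R using (Carrier; _+_; _*_; _-_; -_; 0#; 1#; semiring)
  open RawSemiringDefs (Semiring.rawSemiring semiring) using (_^_; product)

  B : ℕ → Carrier → Carrier
  B n q = foldr _+_ 0# (map (λ w → (- 1#) ^ ℓ w * q ^ β w) (permutations n))

  -- The index k of Fin (n ∸ 1) stands for k + 1 in {1, …, n - 1}.
  ∏[1-qᵏ]ⁿ⁻ᵏ : ℕ → Carrier → Carrier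
  ∏[1-qᵏ]ⁿ⁻ᵏ n q = product {n ∸ 1} (λ k → (1# - q ^ suc (toℕ k)) ^ (n ∸ suc (toℕ k)))

-- Permutations are compared by their values, and `permutations n` meets every
-- class exactly once.

permutationSetoid : ℕ → Setoid 0ℓ 0ℓ
permutationSetoid n = record
  { Carrier       = Permutation′ n
  ; _≈_           = Perm._≈_
  ; isEquivalence = record
    { refl  = λ _ → refl
    ; sym   = λ eq i → sym (eq i)
    ; trans = λ eq eq′ i → trans (eq i) (eq′ i)
    }
  }

permutations-complete : ∀ {n} (w : Permutation′ n) → Any (w Perm.≈_) (permutations n)
permutations-complete {zero}  w = here (λ ())
permutations-complete {suc n} w =
  Any.cartesianProductWith⁺ (insert zero) (λ {j} {v} → glue j v) (∈-allFin (w ⟨$⟩ʳ zero)) (permutations-complete (remove zero w))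
  where
  glue : ∀ j v → w ⟨$⟩ʳ zero ≡ j → remove zero w Perm.≈ v → w Perm.≈ insert zero j v
  glue _ v refl eq zero    = refl
  glue _ v refl eq (suc i) = trans (Perm.punchIn-permute w zero i)
    (trans (cong (punchIn (w ⟨$⟩ʳ zero)) (eq i)) (sym (Perm.insert-punchIn zero (w ⟨$⟩ʳ zero) v i)))

permutations-unique : ∀ n → UniqueSetoid.Unique (permutationSetoid n) (permutations n)
permutations-unique zero    = All.[] ∷ []
permutations-unique (suc n) = UniqueSetoid.cartesianProductWith⁺
  (setoid (Fin (suc n))) (permutationSetoid n) (permutationSetoid (suc n))
  (insert zero) (λ {j} {k} {u} {v} → split j k u v) (Unique.allFin⁺ (suc n)) (permutations-unique n)
  where
  split : ∀ j k u v → insert zero j u Perm.≈ insert zero k v → j ≡ k × u Perm.≈ v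
  split j k u v eq with eq zero
  ... | refl = refl , λ i → Fin.punchIn-injective j _ _
    (trans (sym (Perm.insert-punchIn zero j u i)) (trans (eq (suc i)) (Perm.insert-punchIn zero j v i)))

private
  lookup-injective : ∀ {A : Set} {xs : List A} → Unique xs → Injective _≡_ _≡_ (lookup xs)
  lookup-injective (x∉xs ∷ xs!) {zero}  {zero}  eq = refl
  lookup-injective (x∉xs ∷ xs!) {zero}  {suc j} eq = contradiction eq (All.lookup x∉xs (∈-lookup j))
  lookup-injective (x∉xs ∷ xs!) {suc i} {zero}  eq = contradiction (sym eq) (All.lookup x∉xs (∈-lookup i))
  lookup-injective (x∉xs ∷ xs!) {suc i} {suc j} eq = cong suc (lookup-injective xs! eq)

  length-bound : ∀ {A : Set} {xs : List A} {m} (f : A → ℕ) → Injective _≡_ _≡_ f →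
                 Unique xs → All (λ x → f x < m) xs → length xs ≤ m
  length-bound {xs = xs} f f-inj xs! f<m = Fin.injective⇒≤ {f = λ i → fromℕ< (All.lookup f<m (∈-lookup i))}
    (λ eq → lookup-injective xs! (f-inj (Fin.fromℕ<-injective _ _ _ _ eq)))

cornerSum≤min : ∀ {n} (w : Permutation′ n) i j → cornerSum w i j ≤ suc (toℕ i) ⊓ suc (toℕ j)
cornerSum≤min {n} w i j = ℕ.⊓-glb
  (length-bound toℕ Fin.toℕ-injective ps! (All.map (s≤s ∘ proj₁) bounds))
  (length-bound (λ p → toℕ (w ⟨$⟩ʳ p)) (Injection.injective (↔⇒↣ w) ∘ Fin.toℕ-injective)
    ps! (All.map (s≤s ∘ proj₂) bounds))
  where
  P? = λ p → (p Fin.≤? i) ×-dec (w ⟨$⟩ʳ p Fin.≤? j)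
  ps! = Unique.filter⁺ P? (Unique.allFin⁺ n)
  bounds = All.all-filter P? (allFin n)

private
  sum-mono : ∀ n {f g : Fin n → ℕ} → (∀ i → f i ≤ g i) → ∑[ i < n ] f i ≤ ∑[ i < n ] g i
  sum-mono zero    f≤g = z≤n
  sum-mono (suc n) f≤g = ℕ.+-mono-≤ (f≤g zero) (sum-mono n (f≤g ∘ suc))

cornerSums≤mins : ∀ {n} (w : Permutation′ n) →
  ∑[ i < n ] ∑[ j < n ] cornerSum w i j ≤ ∑[ i < n ] ∑[ j < n ] (suc (toℕ i) ⊓ suc (toℕ j))
cornerSums≤mins {n} w = sum-mono n λ i → sum-mono n λ j → cornerSum≤min w i j

{-# OPTIONS --safe #-}
-- Since ∑ (w(i) - i) = 0, the exponent β(w) = ∑ (w(i) - i)²/2 also equals the sum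
-- of the integers (w(i) - i)(w(i) - i + 1)/2, so that B_n(q) is the determinant
-- of the Toeplitz matrix q^((j - i)(j - i + 1)/2), a Vandermonde determinant in
-- the powers of q up to scaling. Row operations that need no inverse of q
-- reduce it to ∏_{k<n} (1 - q^k) times the determinant of the next smaller size.

module Submission where

open import Defs
open import Algebra.Bundles using (CommutativeRing)
import Algebra.Properties.CommutativeMonoid.Sum as MonoidSum
import Algebra.Properties.CommutativeSemiring.Exp as Exp
import Algebra.Properties.Ring as RingProperties
import Algebra.Properties.Semiring.Sum as SemiringSum
import Algebra.Solver.Ring.NaturalCoefficients.Default as SemiringSolver
open import Data.Bool.Base using (Bool; true; false; _∧_)
open import Data.Fin.Base as Fin using (Fin; zero; suc; toℕ; inject₁; fromℕ; punchIn)
open import Data.Fin.Permutation as Perm using (Permutation′; _⟨$⟩ʳ_; insert)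
import Data.Fin.Properties as Fin
open import Data.List.Base using (List; []; _∷_; _++_; cartesianProduct; cartesianProductWith; filter; foldr; length; map; tabulate)
open import Data.List.Properties using (filter-++; length-++; map-∘; map-tabulate)
open import Data.Nat.Base using (ℕ; zero; suc; _∸_; _≤_; _<_; _⊓_; _<ᵇ_; _≤ᵇ_; s≤s)
import Data.Nat.Base as ℕ
import Data.Nat.Properties as ℕ
open import Data.Nat.Solver using (module +-*-Solver)
open import Data.Product.Base using (_×_; _,_)
open import Function.Base using (_∘_)
open import Relation.Binary.PropositionalEquality using (_≡_; refl; sym; trans; cong; cong₂; module ≡-Reasoning)
open import Relation.Nullary.Decidable.Core using (does; _×-dec_)
open import Relation.Unary using (Decidable)

module ∑ = SemiringSum ℕ.+-*-semiring
open MonoidSum ℕ.+-0-commutativeMonoid using (sum-syntax)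

-- Counting by sums of indicators

indicator : Bool → ℕ
indicator true  = 1
indicator false = 0

indicator-∧ : ∀ a b → indicator (a ∧ b) ≡ indicator a ℕ.* indicator b
indicator-∧ true  b = sym (ℕ.*-identityˡ _)
indicator-∧ false b = refl

∑-zero : ∀ n {f : Fin n → ℕ} → (∀ i → f i ≡ 0) → ∑[ i < n ] f i ≡ 0
∑-zero n f≡0 = trans (∑.sum-cong-≗ {n} f≡0) (∑.sum-replicate-zero n)

module _ {A : Set} {P : A → Set} (P? : Decidable P) where

  length-filter-∷ : ∀ x xs → length (filter P? (x ∷ xs)) ≡ indicator (does (P? x)) ℕ.+ length (filter P? xs)
  length-filter-∷ x xs with does (P? x)
  ... | true  = refl
  ... | false = refl

  length-filter-tabulate : ∀ n (f : Fin n → A) →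
    length (filter P? (tabulate f)) ≡ ∑[ i < n ] indicator (does (P? (f i)))
  length-filter-tabulate zero    f = refl
  length-filter-tabulate (suc n) f = trans (length-filter-∷ (f zero) (tabulate (f ∘ suc)))
    (cong (indicator (does (P? (f zero))) ℕ.+_) (length-filter-tabulate n (f ∘ suc)))

length-filter-cartesianProduct : ∀ {A B : Set} {P : A × B → Set} (P? : Decidable P)
  m n (f : Fin m → A) (g : Fin n → B) →
  length (filter P? (cartesianProduct (tabulate f) (tabulate g))) ≡
  ∑[ i < m ] ∑[ j < n ] indicator (does (P? (f i , g j)))
length-filter-cartesianProduct P? zero    n f g = refl
length-filter-cartesianProduct P? (suc m) n f g = begin
  length (filter P? (map (f zero ,_) (tabulate g) ++ rest))
    ≡⟨ cong length (filter-++ P? (map (f zero ,_) (tabulate g)) rest) ⟩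
  length (filter P? (map (f zero ,_) (tabulate g)) ++ filter P? rest)
    ≡⟨ length-++ (filter P? (map (f zero ,_) (tabulate g))) ⟩
  length (filter P? (map (f zero ,_) (tabulate g))) ℕ.+ length (filter P? rest)
    ≡⟨ cong₂ ℕ._+_
         (trans (cong (length ∘ filter P?) (map-tabulate g (f zero ,_))) (length-filter-tabulate P? n ((f zero ,_) ∘ g)))
         (length-filter-cartesianProduct P? m n (f ∘ suc) g) ⟩
  ∑[ i < suc m ] ∑[ j < n ] indicator (does (P? (f i , g j))) ∎
  where
  open ≡-Reasoning
  rest = cartesianProduct (tabulate (f ∘ suc)) (tabulate g)

-- Inversions

ℓ-∑ : ∀ {n} (w : Permutation′ n) → ℓ w ≡
  ∑[ i < n ] ∑[ j < n ] (indicator (toℕ i <ᵇ toℕ j) ℕ.* indicator (toℕ (w ⟨$⟩ʳ j) <ᵇ toℕ (w ⟨$⟩ʳ i)))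
ℓ-∑ {n} w = trans
  (length-filter-cartesianProduct (λ (i , j) → (i Fin.<? j) ×-dec (w ⟨$⟩ʳ j Fin.<? w ⟨$⟩ʳ i)) n n (λ i → i) (λ j → j))
  (∑.sum-cong-≗ {n} λ i → ∑.sum-cong-≗ {n} λ j → indicator-∧ (toℕ i <ᵇ toℕ j) _)

-- The arguments that `punchIn j` sends below `j` are exactly those it leaves fixed, namely 0, ...,
-- j - 1.
∑-punchIn-< : ∀ n (j : Fin (suc n)) → ∑[ k < n ] indicator (toℕ (punchIn j k) <ᵇ toℕ j) ≡ toℕ j
∑-punchIn-< n       zero    = ∑-zero n λ _ → refl
∑-punchIn-< (suc n) (suc j) = cong suc (∑-punchIn-< n j)

punchIn-<ᵇ : ∀ {n} (j : Fin (suc n)) a b → (toℕ (punchIn j a) <ᵇ toℕ (punchIn j b)) ≡ (toℕ a <ᵇ toℕ b)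
punchIn-<ᵇ zero    a       b       = refl
punchIn-<ᵇ (suc j) zero    zero    = refl
punchIn-<ᵇ (suc j) zero    (suc b) = refl
punchIn-<ᵇ (suc j) (suc a) zero    = refl
punchIn-<ᵇ (suc j) (suc a) (suc b) = punchIn-<ᵇ j a b

-- Index zero is inverted with the positions that hold a value below `j`, and there are `j` such
-- values. All other pairs are ordered as in `v`, since `punchIn j` is increasing.
ℓ-insert : ∀ {n} (j : Fin (suc n)) (v : Permutation′ n) → ℓ (insert zero j v) ≡ toℕ j ℕ.+ ℓ v
ℓ-insert {n} j v = begin
  ℓ w
    ≡⟨ ℓ-∑ w ⟩
  ∑[ k < n ] (1 ℕ.* indicator (toℕ (w ⟨$⟩ʳ suc k) <ᵇ toℕ j)) ℕ.+
  ∑[ i < n ] ∑[ k < n ] (indicator (toℕ i <ᵇ toℕ k) ℕ.* indicator (toℕ (w ⟨$⟩ʳ suc k) <ᵇ toℕ (w ⟨$⟩ʳ suc i)))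
    ≡⟨ cong₂ ℕ._+_ first (trans (∑.sum-cong-≗ {n} λ i → ∑.sum-cong-≗ {n} λ k → rest i k) (sym (ℓ-∑ v))) ⟩
  toℕ j ℕ.+ ℓ v ∎
  where
  open ≡-Reasoning
  w = insert zero j v

  first : ∑[ k < n ] (1 ℕ.* indicator (toℕ (w ⟨$⟩ʳ suc k) <ᵇ toℕ j)) ≡ toℕ j
  first = begin
    ∑[ k < n ] (1 ℕ.* indicator (toℕ (w ⟨$⟩ʳ suc k) <ᵇ toℕ j))
      ≡⟨ ∑.sum-cong-≗ {n} (λ k → trans (ℕ.*-identityˡ _)
           (cong (λ x → indicator (toℕ x <ᵇ toℕ j)) (Perm.insert-punchIn zero j v k))) ⟩
    ∑[ k < n ] indicator (toℕ (punchIn j (v ⟨$⟩ʳ k)) <ᵇ toℕ j)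
      -- The values of `v` exhaust `Fin n`, so the count can be reindexed by them.
      ≡⟨ ∑.sum-permute (λ k → indicator (toℕ (punchIn j k) <ᵇ toℕ j)) v ⟨
    ∑[ k < n ] indicator (toℕ (punchIn j k) <ᵇ toℕ j)
      ≡⟨ ∑-punchIn-< n j ⟩
    toℕ j ∎

  rest : ∀ i k →
    indicator (toℕ i <ᵇ toℕ k) ℕ.* indicator (toℕ (w ⟨$⟩ʳ suc k) <ᵇ toℕ (w ⟨$⟩ʳ suc i)) ≡
    indicator (toℕ i <ᵇ toℕ k) ℕ.* indicator (toℕ (v ⟨$⟩ʳ k) <ᵇ toℕ (v ⟨$⟩ʳ i))
  rest i k = cong (λ b → indicator (toℕ i <ᵇ toℕ k) ℕ.* indicator b) (trans
    (cong₂ (λ x y → toℕ x <ᵇ toℕ y) (Perm.insert-punchIn zero j v k) (Perm.insert-punchIn zero j v i))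
    (punchIn-<ᵇ j _ _))

-- The bigrassmannian statistic

-- Cancelling a successor on both sides of `≤ᵇ` leaves a `<ᵇ` against a successor; this restores
-- `≤ᵇ` for the induction.
<ᵇ-suc : ∀ m n → (m <ᵇ suc n) ≡ (m ≤ᵇ n)
<ᵇ-suc zero    n = refl
<ᵇ-suc (suc m) n = refl

∑-≤ᵇ : ∀ n m → ∑[ i < n ] indicator (m ≤ᵇ toℕ i) ≡ n ∸ m
∑-≤ᵇ zero    m       = sym (ℕ.0∸n≡0 m)
∑-≤ᵇ (suc n) zero    = cong suc (∑-≤ᵇ n zero)
∑-≤ᵇ (suc n) (suc m) = trans (∑.sum-cong-≗ {n} λ i → cong indicator (<ᵇ-suc m (toℕ i))) (∑-≤ᵇ n m)

-- Since `p` counts from zero, the indices below both bounds number one more than the smaller bound.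
-- In this form the minimum is the corner sum of the identity.
⊓-∑ : ∀ {n} (i j : Fin n) →
  suc (toℕ i) ⊓ suc (toℕ j) ≡ ∑[ p < n ] (indicator (toℕ p ≤ᵇ toℕ i) ℕ.* indicator (toℕ p ≤ᵇ toℕ j))
⊓-∑ {suc n} zero    j       = cong suc (sym (∑-zero n λ _ → refl))
⊓-∑ {suc n} (suc i) zero    = cong suc (sym (∑-zero n λ p → ℕ.*-zeroʳ (indicator (toℕ p <ᵇ suc (toℕ i)))))
⊓-∑ {suc n} (suc i) (suc j) = cong suc (trans (⊓-∑ i j) (∑.sum-cong-≗ {n} λ p → sym
  (cong₂ (λ a b → indicator a ℕ.* indicator b) (<ᵇ-suc (toℕ p) (toℕ i)) (<ᵇ-suc (toℕ p) (toℕ j)))))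

-- With `p` fixed, the summand is a function of `i` times a function of `j`, so moving the sum over
-- `p` outside lets the double sum factor.
∑-∑-∑-* : ∀ n (f g : Fin n → Fin n → ℕ) →
  ∑[ i < n ] ∑[ j < n ] ∑[ p < n ] (f p i ℕ.* g p j) ≡ ∑[ p < n ] (∑[ i < n ] f p i ℕ.* ∑[ j < n ] g p j)
∑-∑-∑-* n f g = begin
  ∑[ i < n ] ∑[ j < n ] ∑[ p < n ] (f p i ℕ.* g p j)
    ≡⟨ ∑.sum-cong-≗ {n} (λ i → ∑.∑-comm (λ j p → f p i ℕ.* g p j)) ⟩
  ∑[ i < n ] ∑[ p < n ] ∑[ j < n ] (f p i ℕ.* g p j)
    ≡⟨ ∑.∑-comm (λ i p → ∑[ j < n ] (f p i ℕ.* g p j)) ⟩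
  ∑[ p < n ] ∑[ i < n ] ∑[ j < n ] (f p i ℕ.* g p j)
    ≡⟨ ∑.sum-cong-≗ {n} (λ p → trans (∑.sum-cong-≗ {n} λ i → sym (∑.*-distribˡ-sum (f p i) (g p)))
         (sym (∑.*-distribʳ-sum (∑[ j < n ] g p j) (f p)))) ⟩
  ∑[ p < n ] (∑[ i < n ] f p i ℕ.* ∑[ j < n ] g p j) ∎
  where open ≡-Reasoning

∑∑min : ∀ n → ∑[ i < n ] ∑[ j < n ] (suc (toℕ i) ⊓ suc (toℕ j)) ≡ ∑[ p < n ] ((n ∸ toℕ p) ℕ.* (n ∸ toℕ p))
∑∑min n = trans (∑.sum-cong-≗ {n} λ i → ∑.sum-cong-≗ {n} λ j → ⊓-∑ i j)
  (trans (∑-∑-∑-* n _ _) (∑.sum-cong-≗ {n} λ p → cong₂ ℕ._*_ (∑-≤ᵇ n (toℕ p)) (∑-≤ᵇ n (toℕ p))))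

-- Index `p` is counted in the entries with i ≥ p and j ≥ w(p), which form a rectangle with sides n
-- - p and n - w(p).
∑∑cornerSum : ∀ {n} (w : Permutation′ n) →
  ∑[ i < n ] ∑[ j < n ] cornerSum w i j ≡ ∑[ p < n ] ((n ∸ toℕ p) ℕ.* (n ∸ toℕ (w ⟨$⟩ʳ p)))
∑∑cornerSum {n} w = trans
  (∑.sum-cong-≗ {n} λ i → ∑.sum-cong-≗ {n} λ j → trans
    (length-filter-tabulate (λ p → (p Fin.≤? i) ×-dec (w ⟨$⟩ʳ p Fin.≤? j)) n (λ p → p))
    (∑.sum-cong-≗ {n} λ p → indicator-∧ (toℕ p ≤ᵇ toℕ i) _))
  (trans (∑-∑-∑-* n _ _) (∑.sum-cong-≗ {n} λ p → cong₂ ℕ._*_ (∑-≤ᵇ n (toℕ p)) (∑-≤ᵇ n (toℕ (w ⟨$⟩ʳ p)))))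

-- The Toeplitz exponents and their sum along a permutation

tri : ℕ → ℕ
tri zero    = 0
tri (suc n) = suc n ℕ.+ tri n

-- (j - i)(j - i + 1)/2, also for j < i. The correction (j - i)/2 to (j - i)²/2
-- makes the exponents integers and sums to zero along a permutation.
t : ℕ → ℕ → ℕ
t zero    j       = tri j
t (suc i) zero    = tri i
t (suc i) (suc j) = t i j

t-refl : ∀ i → t i i ≡ 0
t-refl zero    = refl
t-refl (suc i) = t-refl i

-- In the first column the exponent grows by `i` from row `i` to row `i + 1`; this dictates the
-- multiplier q^i of the row operations.
t-sucˡ-zero : ∀ i → t (suc i) 0 ≡ i ℕ.+ t i 0
t-sucˡ-zero zero    = refl
t-sucˡ-zero (suc i) = refl

-- With x = j - i, the value x(x + 1)/2 grows by x + 1 when `j` does; `i` is moved to the left to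
-- avoid a negative difference.
t-sucʳ : ∀ i j → i ℕ.+ t i (suc j) ≡ suc j ℕ.+ t i j
t-sucʳ zero    j       = refl
t-sucʳ (suc i) zero    = cong suc (sym (t-sucˡ-zero i))
t-sucʳ (suc i) (suc j) = cong suc (t-sucʳ i j)

t-+ˡ : ∀ i k → t (i ℕ.+ suc k) i ≡ tri k
t-+ˡ zero    k = refl
t-+ˡ (suc i) k = t-+ˡ i k

t-+ʳ : ∀ i k → t i (i ℕ.+ k) ≡ tri k
t-+ʳ zero    k = refl
t-+ʳ (suc i) k = t-+ʳ i k

-- `t` depends only on the difference of its arguments, and (n - i) - (n - j) = j - i.
t-reflect : ∀ {n i j} → i ≤ n → j ≤ n → t (n ∸ j) (n ∸ i) ≡ t i j
t-reflect {n} {zero}  {j}     _ j≤n = trans (cong (t (n ∸ j)) (sym (ℕ.m∸n+n≡m j≤n))) (t-+ʳ (n ∸ j) j)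
t-reflect {n} {suc i} {zero}  i<n _ = trans (cong (λ k → t k (n ∸ suc i)) (sym (ℕ.m∸n+n≡m i<n))) (t-+ˡ (n ∸ suc i) i)
t-reflect (s≤s i≤n) (s≤s j≤n) = t-reflect i≤n j≤n

-- This is the polarisation ac + (a - c)²/2 = (a² + c²)/2 for c = b + 1; the correction (a - c)/2
-- completes the two squares to triangular numbers.
*-+-t : ∀ a b → a ℕ.* suc b ℕ.+ t (suc b) a ≡ tri a ℕ.+ tri b
*-+-t zero    b       = refl
*-+-t (suc a) zero    = cong suc (trans (cong (ℕ._+ tri a) (ℕ.*-identityʳ a)) (sym (ℕ.+-identityʳ _)))
*-+-t (suc a) (suc b) = begin
  suc a ℕ.* suc (suc b) ℕ.+ t (suc b) a
    ≡⟨ solve 3 (λ a b t → (con 1 :+ a) :* (con 2 :+ b) :+ t := con 1 :+ a :+ (con 1 :+ b) :+ (a :* (con 1 :+ b) :+ t))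
         refl a b (t (suc b) a) ⟩
  suc a ℕ.+ suc b ℕ.+ (a ℕ.* suc b ℕ.+ t (suc b) a)
    ≡⟨ cong (suc a ℕ.+ suc b ℕ.+_) (*-+-t a b) ⟩
  suc a ℕ.+ suc b ℕ.+ (tri a ℕ.+ tri b)
    ≡⟨ solve 4 (λ a b x y → a :+ b :+ (x :+ y) := a :+ x :+ (b :+ y)) refl (suc a) (suc b) (tri a) (tri b) ⟩
  tri (suc a) ℕ.+ tri (suc b) ∎
  where
  open ≡-Reasoning
  open +-*-Solver

∸*∸+t : ∀ {n p j} → p ≤ n → j < n → (n ∸ p) ℕ.* (n ∸ j) ℕ.+ t p j ≡ tri (n ∸ p) ℕ.+ tri (n ∸ suc j)
∸*∸+t {suc n} {p} {j} p≤n (s≤s j≤n) = trans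
  -- Reflection gives `t` the same two differences that occur in the product, and j ≤ n makes n + 1
  -- - j a successor, as `*-+-t` requires.
  (cong₂ ℕ._+_ (cong ((suc n ∸ p) ℕ.*_) n+1∸j) (trans (sym (t-reflect p≤n (ℕ.m≤n⇒m≤1+n j≤n))) (cong (λ b → t b (suc n ∸ p)) n+1∸j)))
  (*-+-t (suc n ∸ p) (n ∸ j))
  where
  n+1∸j : suc n ∸ j ≡ suc (n ∸ j)
  n+1∸j = ℕ.+-∸-assoc 1 j≤n

-- Each summand separates into a term in `p` and a term in w(p). Reindexing the second kind by `w`
-- shows that the total is the same for every permutation.
∑-∸*∸+t : ∀ {n} (w : Permutation′ n) →
  ∑[ p < n ] ((n ∸ toℕ p) ℕ.* (n ∸ toℕ (w ⟨$⟩ʳ p))) ℕ.+ ∑[ p < n ] t (toℕ p) (toℕ (w ⟨$⟩ʳ p)) ≡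
  ∑[ p < n ] tri (n ∸ toℕ p) ℕ.+ ∑[ p < n ] tri (n ∸ suc (toℕ p))
∑-∸*∸+t {n} w = begin
  ∑[ p < n ] ((n ∸ toℕ p) ℕ.* (n ∸ toℕ (w ⟨$⟩ʳ p))) ℕ.+ ∑[ p < n ] t (toℕ p) (toℕ (w ⟨$⟩ʳ p))
    ≡⟨ ∑.∑-distrib-+ {n} _ _ ⟨
  ∑[ p < n ] ((n ∸ toℕ p) ℕ.* (n ∸ toℕ (w ⟨$⟩ʳ p)) ℕ.+ t (toℕ p) (toℕ (w ⟨$⟩ʳ p)))
    ≡⟨ ∑.sum-cong-≗ {n} (λ p → ∸*∸+t (ℕ.<⇒≤ (Fin.toℕ<n p)) (Fin.toℕ<n (w ⟨$⟩ʳ p))) ⟩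
  ∑[ p < n ] (tri (n ∸ toℕ p) ℕ.+ tri (n ∸ suc (toℕ (w ⟨$⟩ʳ p))))
    ≡⟨ ∑.∑-distrib-+ {n} _ _ ⟩
  ∑[ p < n ] tri (n ∸ toℕ p) ℕ.+ ∑[ p < n ] tri (n ∸ suc (toℕ (w ⟨$⟩ʳ p)))
    ≡⟨ cong (∑[ p < n ] tri (n ∸ toℕ p) ℕ.+_) (∑.sum-permute (λ p → tri (n ∸ suc (toℕ p))) w) ⟨
  ∑[ p < n ] tri (n ∸ toℕ p) ℕ.+ ∑[ p < n ] tri (n ∸ suc (toℕ p)) ∎
  where open ≡-Reasoning

β-∑t : ∀ {n} (w : Permutation′ n) → β w ≡ ∑[ p < n ] t (toℕ p) (toℕ (w ⟨$⟩ʳ p))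
β-∑t {n} w = begin
  β w
    ≡⟨ cong₂ _∸_ (∑∑min n) (∑∑cornerSum w) ⟩
  squares ∸ products
    ≡⟨ cong (_∸ products) (ℕ.+-identityʳ squares) ⟨
  squares ℕ.+ 0 ∸ products
    ≡⟨ cong (λ z → squares ℕ.+ z ∸ products) (∑-zero n (λ p → t-refl (toℕ p))) ⟨
  squares ℕ.+ ∑[ p < n ] t (toℕ p) (toℕ p) ∸ products
    -- The common total is compared for the identity, whose exponents `t` all vanish, and for `w`.
    ≡⟨ cong (_∸ products) (trans (∑-∸*∸+t (Perm.id {n})) (sym (∑-∸*∸+t w))) ⟩
  products ℕ.+ ∑[ p < n ] t (toℕ p) (toℕ (w ⟨$⟩ʳ p)) ∸ products
    ≡⟨ ℕ.m+n∸m≡n products _ ⟩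
  ∑[ p < n ] t (toℕ p) (toℕ (w ⟨$⟩ʳ p)) ∎
  where
  open ≡-Reasoning
  squares = ∑[ p < n ] ((n ∸ toℕ p) ℕ.* (n ∸ toℕ p))
  products = ∑[ p < n ] ((n ∸ toℕ p) ℕ.* (n ∸ toℕ (w ⟨$⟩ʳ p)))

-- Determinants

module Determinant {c r} (R : CommutativeRing c r) where
  open CommutativeRing R hiding (zero) renaming (refl to ≈-refl; sym to ≈-sym; trans to ≈-trans)
  open Exp commutativeSemiring using (_^_; ^-congʳ; ^-homo-*)
  open RingProperties ring using (-‿involutive; -1*x≈-x)
  open import Relation.Binary.Reasoning.Setoid setoid
  open SemiringSum semiring using (sum; sum-cong-≋; sum-replicate-zero; ∑-distrib-+; *-distribˡ-sum)
  -- Summation in the multiplicative monoid: `∏.sum` is a finite product.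
  module ∏ = MonoidSum *-commutativeMonoid
  open SemiringSolver commutativeSemiring using (solve; con; _:+_; _:*_; _:=_)

  ε : Carrier
  ε = - 1#

  ε*ε≈1 : ε * ε ≈ 1#
  ε*ε≈1 = ≈-trans (-1*x≈-x ε) (-‿involutive 1#)

  sum-zero : ∀ {n} {f : Fin n → Carrier} → (∀ i → f i ≈ 0#) → sum f ≈ 0#
  sum-zero {n} f≈0 = ≈-trans (sum-cong-≋ f≈0) (sum-replicate-zero n)

  Row : ℕ → Set c
  Row n = Fin n → Carrier

  Matrix : ℕ → ℕ → Set c
  Matrix m n = Fin m → Row n

  dropColumn : ∀ {m n} → Fin (suc n) → Matrix m (suc n) → Matrix m n
  dropColumn j M i k = M i (punchIn j k)

  mutual
    det : ∀ {n} → Matrix n n → Carrier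
    det {zero}  M = 1#
    det {suc n} M = expand (M zero) (M ∘ suc)

    -- The first row is a separate argument, so that it can be split linearly or replaced by a copy
    -- of another row while the minors stay.
    expand : ∀ {n} → Row (suc n) → Matrix n (suc n) → Carrier
    expand u M = sum λ j → ε ^ toℕ j * (u j * det (dropColumn j M))

  mutual
    det-cong : ∀ {n} {M N : Matrix n n} → (∀ i j → M i j ≈ N i j) → det M ≈ det N
    det-cong {zero}  M≈N = ≈-refl
    det-cong {suc n} M≈N = expand-cong (M≈N zero) (M≈N ∘ suc)

    expand-cong : ∀ {n} {u v : Row (suc n)} {M N : Matrix n (suc n)} →
      (∀ j → u j ≈ v j) → (∀ i j → M i j ≈ N i j) → expand u M ≈ expand v N
    expand-cong u≈v M≈N = sum-cong-≋ λ j → *-congˡ {ε ^ toℕ j}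
      (*-cong (u≈v j) (det-cong λ i k → M≈N i (punchIn j k)))

  expand-linear : ∀ {n} (u v : Row (suc n)) d (M : Matrix n (suc n)) →
    expand (λ j → u j + d * v j) M ≈ expand u M + d * expand v M
  expand-linear u v d M = begin
    expand (λ j → u j + d * v j) M
      ≈⟨ sum-cong-≋ (λ j → solve 5 (λ s u v d x → s :* ((u :+ d :* v) :* x) := s :* (u :* x) :+ d :* (s :* (v :* x)))
           ≈-refl (ε ^ toℕ j) (u j) (v j) d (det (dropColumn j M))) ⟩
    sum (λ j → ε ^ toℕ j * (u j * det (dropColumn j M)) + d * (ε ^ toℕ j * (v j * det (dropColumn j M))))
      ≈⟨ ∑-distrib-+ (λ j → ε ^ toℕ j * (u j * det (dropColumn j M))) (λ j → d * (ε ^ toℕ j * (v j * det (dropColumn j M)))) ⟩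
    expand u M + sum (λ j → d * (ε ^ toℕ j * (v j * det (dropColumn j M))))
      ≈⟨ +-congˡ (*-distribˡ-sum d (λ j → ε ^ toℕ j * (v j * det (dropColumn j M)))) ⟨
    expand u M + d * expand v M ∎

  -- The pairs (j , k) with j = 0 cancel against those with j > 0 and k = 0;
  -- the remaining ones form the same sum over columns 1, 2, ….
  ∑∑-punchIn-cancel : ∀ n (u : Row (suc (suc n))) (Φ : (Fin n → Fin (suc (suc n))) → Carrier) →
    (∀ {f g} → (∀ l → f l ≡ g l) → Φ f ≈ Φ g) →
    sum (λ j → ε ^ toℕ j * (u j * sum λ k → ε ^ toℕ k * (u (punchIn j k) * Φ (punchIn j ∘ punchIn k)))) ≈ 0#
  ∑∑-punchIn-cancel n u Φ Φ-cong = begin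
    1# * (u zero * sum inner₀) + sum outer
      ≈⟨ +-cong
           (≈-trans (*-identityˡ _) (*-distribˡ-sum (u zero) inner₀))
           (≈-trans (sum-cong-≋ split) (≈-trans (∑-distrib-+ (λ j → ε * (u zero * inner₀ j)) rest)
             (+-congʳ (≈-sym (*-distribˡ-sum ε (λ j → u zero * inner₀ j)))))) ⟩
    A + (ε * A + sum rest)
      ≈⟨ +-congˡ (+-congˡ (rest≈0 n u Φ Φ-cong)) ⟩
    A + (ε * A + 0#)
      ≈⟨ solve 2 (λ a e → a :+ (e :* a :+ con 0) := (con 1 :+ e) :* a) ≈-refl A ε ⟩
    (1# + ε) * A
      ≈⟨ *-congʳ (-‿inverseʳ 1#) ⟩
    0# * A
      ≈⟨ zeroˡ A ⟩
    0# ∎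
    where
    inner₀ : Fin (suc n) → Carrier
    inner₀ k = ε ^ toℕ k * (u (suc k) * Φ (suc ∘ punchIn k))

    A : Carrier
    A = sum λ k → u zero * inner₀ k

    inner : ∀ {n} (u : Row (suc (suc n))) (Φ : (Fin n → Fin (suc (suc n))) → Carrier) → Fin (suc n) → Fin n → Carrier
    inner u Φ j k = ε ^ toℕ k * (u (suc (punchIn j k)) * Φ (punchIn (suc j) ∘ punchIn (suc k)))

    rest′ : ∀ {n} (u : Row (suc (suc n))) (Φ : (Fin n → Fin (suc (suc n))) → Carrier) → Fin (suc n) → Carrier
    rest′ u Φ j = ε ^ toℕ j * (u (suc j) * sum (inner u Φ j))

    rest : Fin (suc n) → Carrier
    rest = rest′ u Φ

    outer : Fin (suc n) → Carrier
    outer j = ε ^ suc (toℕ j) * (u (suc j) *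
      sum λ k → ε ^ toℕ k * (u (punchIn (suc j) k) * Φ (punchIn (suc j) ∘ punchIn k)))

    split : ∀ j → outer j ≈ ε * (u zero * inner₀ j) + rest j
    split j = begin
      (ε * e) * (a * (1# * (u zero * Φ (punchIn (suc j) ∘ suc)) + sum λ k → ε ^ suc (toℕ k) * (u (suc (punchIn j k)) * Φ (punchIn (suc j) ∘ punchIn (suc k)))))
        ≈⟨ *-congˡ (*-congˡ (+-cong (≈-trans (*-identityˡ _) (*-congˡ (Φ-cong λ _ → refl)))
             (≈-trans (sum-cong-≋ {n} (λ k → *-assoc ε (ε ^ toℕ k) _)) (≈-sym (*-distribˡ-sum ε (inner u Φ j)))))) ⟩
      (ε * e) * (a * (u zero * φ + ε * sum (inner u Φ j)))
        ≈⟨ solve 6 (λ m e a b p s → (m :* e) :* (a :* (b :* p :+ m :* s)) := m :* (b :* (e :* (a :* p))) :+ (m :* m) :* (e :* (a :* s)))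
             ≈-refl ε e a (u zero) φ (sum (inner u Φ j)) ⟩
      ε * (u zero * inner₀ j) + (ε * ε) * rest j
        -- The shifts of `j` and of `k` each contribute one sign, and the two signs cancel.
        ≈⟨ +-congˡ (≈-trans (*-congʳ ε*ε≈1) (*-identityˡ (rest j))) ⟩
      ε * (u zero * inner₀ j) + rest j ∎
      where
      e = ε ^ toℕ j
      a = u (suc j)
      φ = Φ (suc ∘ punchIn j)

    -- Removing two columns other than column zero keeps column zero, which `Fin.lift 1` accounts
    -- for; what remains is the cancelling sum with one column fewer. For `n = 0` the inner sums are
    -- empty.
    rest≈0 : ∀ n (u : Row (suc (suc n))) (Φ : (Fin n → Fin (suc (suc n))) → Carrier) →
      (∀ {f g} → (∀ l → f l ≡ g l) → Φ f ≈ Φ g) → sum (rest′ u Φ) ≈ 0#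
    rest≈0 zero    u Φ Φ-cong = sum-zero λ j → ≈-trans (*-congˡ (zeroʳ (u (suc j)))) (zeroʳ (ε ^ toℕ j))
    rest≈0 (suc n) u Φ Φ-cong = ≈-trans
      (sum-cong-≋ λ j → *-congˡ {ε ^ toℕ j} (*-congˡ {u (suc j)} (sum-cong-≋ λ k →
        *-congˡ {ε ^ toℕ k} (*-congˡ {u (suc (punchIn j k))} (Φ-cong (punchIn-lift j k))))))
      (∑∑-punchIn-cancel n (u ∘ suc) (Φ ∘ Fin.lift 1) λ f≗g → Φ-cong (lift-cong f≗g))
      where
      lift-cong : ∀ {m n} {f g : Fin m → Fin n} → (∀ l → f l ≡ g l) → ∀ l → Fin.lift 1 f l ≡ Fin.lift 1 g l
      lift-cong f≗g zero    = refl
      lift-cong f≗g (suc l) = cong suc (f≗g l)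

      punchIn-lift : ∀ {n} (j : Fin (suc (suc n))) (k : Fin (suc n)) l →
        punchIn (suc j) (punchIn (suc k) l) ≡ Fin.lift 1 (punchIn j ∘ punchIn k) l
      punchIn-lift j k zero    = refl
      punchIn-lift j k (suc l) = refl

  -- The sum is the twofold expansion of a determinant whose first two rows both equal `u`. The
  -- minors depend only on which columns survive, so they can serve as `Φ`.
  expand-alternating : ∀ {n} (u : Row (suc (suc n))) (M : Matrix n (suc (suc n))) →
    sum (λ j → ε ^ toℕ j * (u j * expand (u ∘ punchIn j) (dropColumn j M))) ≈ 0#
  expand-alternating {n} u M = ∑∑-punchIn-cancel n u (λ f → det λ i l → M i (f l))
    λ f≗g → det-cong λ i l → reflexive (cong (M i) (f≗g l))

  -- All rows change at once, each by a multiple of the unmodified row above it, as if the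
  -- operations were performed from the bottom row upwards.
  rowOperation : ∀ {n m} → (Fin n → Carrier) → Matrix (suc n) m → Matrix (suc n) m
  rowOperation d M zero    j = M zero j
  rowOperation d M (suc i) j = M (suc i) j + d i * M (inject₁ i) j

  -- By linearity in the second row, the determinant splits in two. The minors `x j` are again row
  -- operations, on the rows below the first, and the induction applies; the part with `y j` has its
  -- first row repeated and vanishes.
  det-rowOperation : ∀ {n} (d : Fin n → Carrier) (M : Matrix (suc n) (suc n)) → det (rowOperation d M) ≈ det M
  det-rowOperation {zero}  d M = det-cong {M = rowOperation d M} {N = M} λ { zero j → ≈-refl }
  det-rowOperation {suc n} d M = begin
    sum (λ j → s j * (M zero j * expand (λ k → M (suc zero) (punchIn j k) + d zero * M zero (punchIn j k)) (rest j)))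
      ≈⟨ sum-cong-≋ (λ j → ≈-trans
           (*-congˡ {s j} (*-congˡ (expand-linear (M (suc zero) ∘ punchIn j) (M zero ∘ punchIn j) (d zero) (rest j))))
           (solve 5 (λ s m x d y → s :* (m :* (x :+ d :* y)) := s :* (m :* x) :+ d :* (s :* (m :* y)))
             ≈-refl (s j) (M zero j) (x j) (d zero) (y j))) ⟩
    sum (λ j → s j * (M zero j * x j) + d zero * (s j * (M zero j * y j)))
      ≈⟨ ∑-distrib-+ (λ j → s j * (M zero j * x j)) (λ j → d zero * (s j * (M zero j * y j))) ⟩
    sum (λ j → s j * (M zero j * x j)) + sum (λ j → d zero * (s j * (M zero j * y j)))
      ≈⟨ +-cong
           (sum-cong-≋ λ j → *-congˡ {s j} (*-congˡ {M zero j} (det-rowOperation (d ∘ suc) (dropColumn j (M ∘ suc)))))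
           (≈-trans (≈-sym (*-distribˡ-sum (d zero) (λ j → s j * (M zero j * y j))))
             (≈-trans (*-congˡ (expand-alternating (M zero) (λ i → rowOperation d M (suc (suc i))))) (zeroʳ (d zero)))) ⟩
    det M + 0#
      ≈⟨ +-identityʳ (det M) ⟩
    det M ∎
    where
    s : Fin (suc (suc n)) → Carrier
    s j = ε ^ toℕ j

    rest : Fin (suc (suc n)) → Matrix n (suc n)
    rest j = dropColumn j (λ i → rowOperation d M (suc (suc i)))

    x y : Fin (suc (suc n)) → Carrier
    x j = expand (M (suc zero) ∘ punchIn j) (rest j)
    y j = expand (M zero ∘ punchIn j) (rest j)

  -- The term of column zero has a zero entry as factor; every other minor still contains the zero
  -- column, so induction applies.
  det-zeroColumn : ∀ {n} (M : Matrix (suc n) (suc n)) → (∀ i → M i zero ≈ 0#) → det M ≈ 0#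
  det-zeroColumn {n} M M≈0 = sum-zero (term n M M≈0)
    where
    term : ∀ n (M : Matrix (suc n) (suc n)) → (∀ i → M i zero ≈ 0#) → ∀ j →
      ε ^ toℕ j * (M zero j * det (dropColumn j (M ∘ suc))) ≈ 0#
    term n       M M≈0 zero    = ≈-trans (*-identityˡ _) (≈-trans (*-congʳ (M≈0 zero)) (zeroˡ _))
    term (suc n) M M≈0 (suc j) = ≈-trans
      (*-congˡ (≈-trans (*-congˡ (det-zeroColumn (dropColumn (suc j) (M ∘ suc)) (M≈0 ∘ suc))) (zeroʳ _))) (zeroʳ _)

  det-firstColumn : ∀ {n} (M : Matrix (suc n) (suc n)) → (∀ i → M (suc i) zero ≈ 0#) →
    det M ≈ M zero zero * det (dropColumn zero (M ∘ suc))
  det-firstColumn {n} M M≈0 = ≈-trans (+-cong (*-identityˡ _) (sum-zero (term n M M≈0))) (+-identityʳ _)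
    where
    term : ∀ n (M : Matrix (suc n) (suc n)) → (∀ i → M (suc i) zero ≈ 0#) → ∀ j →
      ε ^ suc (toℕ j) * (M zero (suc j) * det (dropColumn (suc j) (M ∘ suc))) ≈ 0#
    term (suc n) M M≈0 j = ≈-trans
      (*-congˡ (≈-trans (*-congˡ (det-zeroColumn (dropColumn (suc j) (M ∘ suc)) M≈0)) (zeroʳ _))) (zeroʳ _)

  -- In the term of column `j`, the first row supplies the factor `d j` and the minor all the
  -- others, so every term carries the full product.
  det-scaleColumns : ∀ {n} (d : Fin n → Carrier) (M : Matrix n n) →
    det (λ i j → d j * M i j) ≈ ∏.sum d * det M
  det-scaleColumns {zero}  d M = ≈-sym (*-identityˡ 1#)
  det-scaleColumns {suc n} d M = ≈-trans
    (sum-cong-≋ λ j → begin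
      s j * ((d j * M zero j) * det (λ i k → d (punchIn j k) * M (suc i) (punchIn j k)))
        ≈⟨ *-congˡ (*-congˡ (det-scaleColumns (d ∘ punchIn j) (dropColumn j (M ∘ suc)))) ⟩
      s j * ((d j * M zero j) * (∏.sum (d ∘ punchIn j) * D j))
        ≈⟨ solve 5 (λ s d m p x → s :* ((d :* m) :* (p :* x)) := (d :* p) :* (s :* (m :* x)))
             ≈-refl (s j) (d j) (M zero j) (∏.sum (d ∘ punchIn j)) (D j) ⟩
      (d j * ∏.sum (d ∘ punchIn j)) * (s j * (M zero j * D j))
        ≈⟨ *-congʳ (∏.sum-remove {i = j} d) ⟨
      ∏.sum d * (s j * (M zero j * D j)) ∎)
    (≈-sym (*-distribˡ-sum (∏.sum d) (λ j → s j * (M zero j * D j))))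
    where
    s D : Fin (suc n) → Carrier
    s j = ε ^ toℕ j
    D j = det (dropColumn j (M ∘ suc))

  -- The Leibniz formula

  ∑ᴸ : {A : Set} → (A → Carrier) → List A → Carrier
  ∑ᴸ f xs = foldr _+_ 0# (map f xs)

  ∑ᴸ-cong : ∀ {A : Set} {f g : A → Carrier} → (∀ x → f x ≈ g x) → ∀ xs → ∑ᴸ f xs ≈ ∑ᴸ g xs
  ∑ᴸ-cong f≈g []       = ≈-refl
  ∑ᴸ-cong f≈g (x ∷ xs) = +-cong (f≈g x) (∑ᴸ-cong f≈g xs)

  ∑ᴸ-++ : ∀ {A : Set} (f : A → Carrier) xs ys → ∑ᴸ f (xs ++ ys) ≈ ∑ᴸ f xs + ∑ᴸ f ys
  ∑ᴸ-++ f []       ys = ≈-sym (+-identityˡ _)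
  ∑ᴸ-++ f (x ∷ xs) ys = ≈-trans (+-congˡ (∑ᴸ-++ f xs ys)) (≈-sym (+-assoc _ _ _))

  *-distribˡ-∑ᴸ : ∀ {A : Set} a (f : A → Carrier) xs → ∑ᴸ (λ x → a * f x) xs ≈ a * ∑ᴸ f xs
  *-distribˡ-∑ᴸ a f []       = ≈-sym (zeroʳ a)
  *-distribˡ-∑ᴸ a f (x ∷ xs) = ≈-trans (+-congˡ (*-distribˡ-∑ᴸ a f xs)) (≈-sym (distribˡ a _ _))

  ∑ᴸ-cartesianProductWith : ∀ {A B C : Set} (f : C → Carrier) (g : A → B → C) n (h : Fin n → A) ys →
    ∑ᴸ f (cartesianProductWith g (tabulate h) ys) ≈ sum (λ i → ∑ᴸ (f ∘ g (h i)) ys)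
  ∑ᴸ-cartesianProductWith f g zero    h ys = ≈-refl
  ∑ᴸ-cartesianProductWith f g (suc n) h ys = ≈-trans
    (∑ᴸ-++ f (map (g (h zero)) ys) (cartesianProductWith g (tabulate (h ∘ suc)) ys))
    (+-cong (reflexive (cong (foldr _+_ 0#) (sym (map-∘ ys)))) (∑ᴸ-cartesianProductWith f g n (h ∘ suc) ys))

  -- The recursion of `permutations` on the value `j` at index zero matches the expansion along the
  -- first row: by `ℓ-insert`, the inversions of index zero give the cofactor sign.
  leibniz : ∀ {n} (M : Matrix n n) →
    ∑ᴸ (λ w → ε ^ ℓ w * ∏.sum (λ i → M i (w ⟨$⟩ʳ i))) (permutations n) ≈ det M
  leibniz {zero}  M = ≈-trans (+-identityʳ _) (*-identityˡ 1#)
  leibniz {suc n} M = ≈-trans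
    (∑ᴸ-cartesianProductWith (λ w → ε ^ ℓ w * ∏.sum (λ i → M i (w ⟨$⟩ʳ i))) (insert zero) (suc n) (λ j → j) (permutations n))
    (sum-cong-≋ λ j → begin
      ∑ᴸ (λ v → ε ^ ℓ (insert zero j v) * ∏.sum (λ i → M i (insert zero j v ⟨$⟩ʳ i))) (permutations n)
        ≈⟨ ∑ᴸ-cong (λ v → begin
             ε ^ ℓ (insert zero j v) * (M zero j * ∏.sum (λ i → M (suc i) (insert zero j v ⟨$⟩ʳ suc i)))
               ≈⟨ *-cong
                    (≈-trans (^-congʳ ε (ℓ-insert j v)) (^-homo-* ε (toℕ j) (ℓ v)))
                    (*-congˡ (∏.sum-cong-≋ λ i → reflexive (cong (M (suc i)) (Perm.insert-punchIn zero j v i)))) ⟩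
             (ε ^ toℕ j * ε ^ ℓ v) * (M zero j * P j v)
               ≈⟨ solve 4 (λ s l m p → (s :* l) :* (m :* p) := (s :* m) :* (l :* p)) ≈-refl (ε ^ toℕ j) (ε ^ ℓ v) (M zero j) (P j v) ⟩
             (ε ^ toℕ j * M zero j) * (ε ^ ℓ v * P j v) ∎) (permutations n) ⟩
      ∑ᴸ (λ v → (ε ^ toℕ j * M zero j) * (ε ^ ℓ v * P j v)) (permutations n)
        ≈⟨ *-distribˡ-∑ᴸ _ (λ v → ε ^ ℓ v * P j v) (permutations n) ⟩
      (ε ^ toℕ j * M zero j) * ∑ᴸ (λ v → ε ^ ℓ v * P j v) (permutations n)
        ≈⟨ ≈-trans (*-congˡ (leibniz (dropColumn j (M ∘ suc)))) (*-assoc _ _ _) ⟩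
      ε ^ toℕ j * (M zero j * det (dropColumn j (M ∘ suc))) ∎)
    where
    P : Fin (suc n) → Permutation′ n → Carrier
    P j v = ∏.sum λ i → M (suc i) (punchIn j (v ⟨$⟩ʳ i))

-- The Toeplitz determinant and the product formula

module _ {c r} (R : CommutativeRing c r) (q : CommutativeRing.Carrier R) where
  open CommutativeRing R hiding (zero) renaming (refl to ≈-refl; sym to ≈-sym; trans to ≈-trans)
  open Determinant R
  open Exp commutativeSemiring using (_^_; ^-congʳ; ^-homo-*)
  open RingProperties ring using (-‿distribˡ-*)
  open import Relation.Binary.Reasoning.Setoid setoid

  toeplitz : ∀ n → Matrix n n
  toeplitz n i j = q ^ t (toℕ i) (toℕ j)

  ^-∑ : ∀ n (f : Fin n → ℕ) → q ^ (∑[ i < n ] f i) ≈ ∏.sum (λ i → q ^ f i)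
  ^-∑ zero    f = ≈-refl
  ^-∑ (suc n) f = ≈-trans (^-homo-* q (f zero) _) (*-congˡ (^-∑ n (f ∘ suc)))

  B≈det : ∀ n → B R n q ≈ det (toeplitz n)
  B≈det n = ≈-trans
    (∑ᴸ-cong (λ w → *-congˡ {ε ^ ℓ w} (≈-trans (^-congʳ q (β-∑t w)) (^-∑ n _))) (permutations n))
    (leibniz (toeplitz n))

  1-q^ : ∀ {n} → Fin n → Carrier
  1-q^ j = 1# - q ^ suc (toℕ j)

  -- Subtracting q^i times row i from row i + 1 clears the first column below
  -- the diagonal and turns entry (i + 1, j + 1) into (1 - q^(j + 1)) q^t(i, j).
  det-toeplitz-suc : ∀ n → det (toeplitz (suc n)) ≈ ∏.sum (1-q^ {n}) * det (toeplitz n)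
  det-toeplitz-suc n = begin
    det (toeplitz (suc n))
      ≈⟨ det-rowOperation d (toeplitz (suc n)) ⟨
    det N
      ≈⟨ det-firstColumn N (λ i → begin
           q ^ t (suc (toℕ i)) 0 + - q ^ toℕ i * q ^ t (toℕ (inject₁ i)) 0
             ≈⟨ +-cong (^-congʳ q (t-sucˡ-zero (toℕ i))) (eliminate i 0) ⟩
           q ^ (toℕ i ℕ.+ t (toℕ i) 0) - q ^ (toℕ i ℕ.+ t (toℕ i) 0)
             ≈⟨ -‿inverseʳ _ ⟩
           0# ∎) ⟩
    -- The corner entry q^t(0, 0) computes to 1.
    1# * det (dropColumn zero (N ∘ suc))
      ≈⟨ *-identityˡ _ ⟩
    det (dropColumn zero (N ∘ suc))
      ≈⟨ det-cong (λ i j → begin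
           q ^ t (toℕ i) (toℕ j) + - q ^ toℕ i * q ^ t (toℕ (inject₁ i)) (suc (toℕ j))
             -- `t-sucʳ` trades the power q^i of the row for the power q^(j + 1) of the column, so
             -- that the common factor depends on the column alone.
             ≈⟨ +-cong (≈-sym (*-identityˡ _)) (≈-trans (eliminate i (suc (toℕ j)))
                  (≈-trans (-‿cong (≈-trans (^-congʳ q (t-sucʳ (toℕ i) (toℕ j))) (^-homo-* q (suc (toℕ j)) (t (toℕ i) (toℕ j)))))
                    (-‿distribˡ-* _ _))) ⟩
           1# * q ^ t (toℕ i) (toℕ j) + - q ^ suc (toℕ j) * q ^ t (toℕ i) (toℕ j)
             ≈⟨ distribʳ _ 1# (- q ^ suc (toℕ j)) ⟨
           1-q^ j * q ^ t (toℕ i) (toℕ j) ∎) ⟩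
    det (λ i j → 1-q^ j * toeplitz n i j)
      ≈⟨ det-scaleColumns 1-q^ (toeplitz n) ⟩
    ∏.sum (1-q^ {n}) * det (toeplitz n) ∎
    where
    d : Fin n → Carrier
    d i = - q ^ toℕ i

    N : Matrix (suc n) (suc n)
    N = rowOperation d (toeplitz (suc n))

    eliminate : ∀ (i : Fin n) j → - q ^ toℕ i * q ^ t (toℕ (inject₁ i)) j ≈ - q ^ (toℕ i ℕ.+ t (toℕ i) j)
    eliminate i j = ≈-trans (≈-sym (-‿distribˡ-* _ _)) (-‿cong
      (≈-trans (*-congˡ (^-congʳ q (cong (λ k → t k j) (Fin.toℕ-inject₁ i)))) (≈-sym (^-homo-* q (toℕ i) _))))

  -- Passing from `n` to `n + 1` raises the exponent of every old factor by one and adds the new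
  -- factor 1 - q^n.
  ∏-suc : ∀ n → ∏[1-qᵏ]ⁿ⁻ᵏ R (suc n) q ≈ ∏.sum (1-q^ {n}) * ∏[1-qᵏ]ⁿ⁻ᵏ R n q
  -- All products are empty here, the last one because `0 ∸ 1` is `0`.
  ∏-suc zero    = ≈-sym (*-identityˡ 1#)
  ∏-suc (suc n) = begin
    ∏.sum (λ k → 1-q^ {suc n} k ^ (suc n ∸ toℕ k))
      ≈⟨ ∏.sum-cong-≋ {suc n} (λ k → ^-congʳ (1-q^ k) (ℕ.+-∸-assoc 1 (ℕ.s≤s⁻¹ (Fin.toℕ<n k)))) ⟩
    ∏.sum (λ k → 1-q^ {suc n} k * 1-q^ k ^ (n ∸ toℕ k))
      ≈⟨ ∏.∑-distrib-+ (1-q^ {suc n}) (λ k → 1-q^ k ^ (n ∸ toℕ k)) ⟩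
    ∏.sum (1-q^ {suc n}) * ∏.sum (λ k → 1-q^ {suc n} k ^ (n ∸ toℕ k))
      -- The last index is split off: its remaining exponent is n - n = 0, so it contributes 1.
      ≈⟨ *-congˡ (∏.sum-init-last (λ k → 1-q^ {suc n} k ^ (n ∸ toℕ k))) ⟩
    ∏.sum (1-q^ {suc n}) * (∏.sum (λ k → 1-q^ (inject₁ {n} k) ^ (n ∸ toℕ (inject₁ k))) * 1-q^ (fromℕ n) ^ (n ∸ toℕ (fromℕ n)))
      ≈⟨ *-congˡ (*-cong
           (∏.sum-cong-≋ {n} λ k → reflexive (cong (λ i → (1# - q ^ suc i) ^ (n ∸ i)) (Fin.toℕ-inject₁ k)))
           (^-congʳ (1-q^ (fromℕ n)) (trans (cong (n ∸_) (Fin.toℕ-fromℕ n)) (ℕ.n∸n≡0 n)))) ⟩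
    ∏.sum (1-q^ {suc n}) * (∏.sum (λ k → 1-q^ {n} k ^ (n ∸ toℕ k)) * 1#)
      ≈⟨ *-congˡ (*-identityʳ _) ⟩
    ∏.sum (1-q^ {suc n}) * ∏.sum (λ k → 1-q^ {n} k ^ (n ∸ toℕ k)) ∎

  det-toeplitz : ∀ n → det (toeplitz n) ≈ ∏[1-qᵏ]ⁿ⁻ᵏ R n q
  det-toeplitz zero    = ≈-refl
  det-toeplitz (suc n) = ≈-trans (det-toeplitz-suc n) (≈-trans (*-congˡ (det-toeplitz n)) (≈-sym (∏-suc n)))

theorem5p3 : ∀ {c r} (R : CommutativeRing c r) (q : CommutativeRing.Carrier R) (n : ℕ) → 1 ≤ n →
    CommutativeRing._≈_ R (B R n q) (∏[1-qᵏ]ⁿ⁻ᵏ R n q)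
theorem5p3 R q n _ = CommutativeRing.trans R (B≈det R q n) (det-toeplitz R q n)
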